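{- Let $(C,e,\lambda,\oplus)$ be the free Catalan structure, and let $h,\mathrm{rev}\colon C\to C$ be the (size-preserving) involutions defined in the context. The group $\langle h,\mathrm{rev}\rangle$ of permutations of $C$ generated by $h$ and $\mathrm{rev}$ is the free product $\mathbb{Z}_2*\mathbb{Z}_2$ (of the order-two groups generated by $h$ and by $\mathrm{rev}$). In particular, $M=h\circ\mathrm{rev}$ has infinite order, and the orders $\operatorname{ord}(M|_{C_n})$, $n\ge 0$, of the permutations that $M$ induces on the finite sets $C_n$ are unbounded.
   Context: A Catalan structure is a quadruple $(C,e,\lambda,\oplus)$ where $C=\bigsqcup_{n\ge 0}C_n$ with $C_0=\{e\}$ ($|t|=n$ for $t\in C_n$), $\lambda\colon C_n\to C_{n+1}$, $\oplus\colon C_m\times C_n\to C_{m+n}$, $\oplus$ is associative with two-sided identity $e$, and every $t\in C$ can be written uniquely in exactly one of three forms: $t=e$; $t=\lambda(s)$ with $s\in C$ (indecomposable); $t=u\oplus v$ with $u$ indecomposable and $v\in C\setminus C_0$ (decomposable). Hence every nonempty $t$ is uniquely $\lambda(u)\oplus v$ ($v=e$ allowed). The free Catalan structure is realized by the formal expressions $e$, $\lambda(t)$, $\lambda(u)\oplus v$ with $v\ne e$; it is isomorphic to rooted plane trees written as lists of children, with $e=[\,]$, $\lambda(T)=[T]$, $\oplus$ = concatenation of child lists, size = number of edges. Put $\gamma(t)=t\oplus\lambda(e)$ and define $\ominus$ by $e\ominus v=v$, $\lambda(u)\ominus v=\lambda(u\ominus v)$, $(t\oplus u)\ominus v=t\oplus(u\ominus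 v)$ for $t,u\ne e$ (well defined; one may take $t$ indecomposable). The maps: $h(e)=e$, $h(\lambda(u)\oplus v)=h(v)\ominus\gamma(h(u))$; $\mathrm{rev}(e)=e$, $\mathrm{rev}(\lambda(u)\oplus v)=\mathrm{rev}(v)\oplus\lambda(\mathrm{rev}(u))$. -}

module Defs where

open import Algebra.Bundles using (Group)
open import Algebra.Structures using (IsMonoid)
import Algebra.Definitions.RawMonoid as RawMonoidDefinitions
import Data.Parity.Properties as Parity
open import Data.Empty using (⊥-elim; ⊥-elim-irr)
open import Data.List.Base using (List; []; _∷_; _++_; [_])
open import Data.List.Properties using (++-assoc; ++-identityʳ)
open import Data.Nat.Base using (ℕ; suc; _+_; _<_)
open import Data.Nat.Properties using (+-assoc; +-comm; +-identityʳ; ≡-irrelevant)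
open import Data.Product.Base using (∃; ∃-syntax; Σ-syntax; _×_; _,_; proj₁; proj₂)
open import Data.Sum.Base using (_⊎_; inj₁; inj₂)
open import Function.Bundles using (_↔_; Inverse; mk↔ₛ′)
open import Function.Construct.Composition using (_↔-∘_)
open import Function.Construct.Identity using (↔-id)
open import Function.Construct.Symmetry using (↔-sym)
open import Level using (0ℓ; _⊔_)
open import Relation.Binary.PropositionalEquality
  using (_≡_; _≢_; refl; sym; trans; cong; cong₂; isEquivalence; module ≡-Reasoning)
open import Relation.Nullary.Negation using (¬_)
open import Relation.Unary using (Pred)

-- The set is given as a type C with a size function; C_n is the fibre over n.
module _ {C : Set} (size : C → ℕ) (e : C) (ƛ : C → C) (_⊕_ : C → C → C) where

  data Form (t : C) : Set where
    empty          : t ≡ e → Form t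
    indecomposable : (s : C) → t ≡ ƛ s → Form t
    -- v ≢ e is irrelevant so that equality of forms compares only u and v.
    decomposable   : (u v : C) → .(v ≢ e) → t ≡ (ƛ u ⊕ v) → Form t

  record IsCatalanStructure : Set where
    field
      size-e        : size e ≡ 0
      size-0        : ∀ t → size t ≡ 0 → t ≡ e
      size-ƛ        : ∀ t → size (ƛ t) ≡ suc (size t)
      size-⊕        : ∀ t u → size (t ⊕ u) ≡ size t + size u
      ⊕-e-isMonoid  : IsMonoid _≡_ _⊕_ e
      form          : ∀ t → Form t
      form-unique   : ∀ {t} (p q : Form t) → p ≡ q

-- Formal expressions e, ƛ u and ƛ u ⊕ v with v ≢ e, of which node u v is the last
-- when v ≢ e, while ƛ u is node u e.
data C : Set where
  e    : C
  node : (u v : C) → C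

infixr 6 _⊕_ _⊖_

ƛ : C → C
ƛ u = node u e

_⊕_ : C → C → C
e        ⊕ w = w
node u v ⊕ w = node u (v ⊕ w)

size : C → ℕ
size e          = 0
size (node u v) = suc (size u + size v)

γ : C → C
γ t = t ⊕ ƛ e

_⊖_ : C → C → C
e                   ⊖ w = w
node u e            ⊖ w = ƛ (u ⊖ w)
node u v@(node _ _) ⊖ w = ƛ u ⊕ (v ⊖ w)

h : C → C
h e          = e
h (node u v) = h v ⊖ γ (h u)

rev : C → C
rev e          = e
rev (node u v) = rev v ⊕ ƛ (rev u)

⊕-assoc : ∀ t u v → (t ⊕ u) ⊕ v ≡ t ⊕ (u ⊕ v)
⊕-assoc e          u v = refl
⊕-assoc (node a b) u v = cong (node a) (⊕-assoc b u v)

⊕-identityʳ : ∀ t → t ⊕ e ≡ t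
⊕-identityʳ e          = refl
⊕-identityʳ (node a b) = cong (node a) (⊕-identityʳ b)

size-⊕ : ∀ t u → size (t ⊕ u) ≡ size t + size u
size-⊕ e          u = refl
size-⊕ (node a b) u = cong suc
  (trans (cong (size a +_) (size-⊕ b u)) (sym (+-assoc (size a) (size b) (size u))))

isCatalanStructure : IsCatalanStructure size e ƛ _⊕_
isCatalanStructure = record
  { size-e       = refl
  ; size-0       = λ { e _ → refl }
  ; size-ƛ       = λ t → cong suc (+-identityʳ (size t))
  ; size-⊕       = size-⊕
  ; ⊕-e-isMonoid = record
      { isSemigroup = record
          { isMagma = record { isEquivalence = isEquivalence ; ∙-cong = cong₂ _⊕_ }
          ; assoc   = ⊕-assoc
          }
      ; identity = (λ _ → refl) , ⊕-identityʳ
      }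
  ; form         = form
  ; form-unique  = unique
  }
  where
  F : C → Set
  F = Form size e ƛ _⊕_

  form : ∀ t → F t
  form e                     = empty refl
  form (node u e)            = indecomposable u refl
  form (node u v@(node _ _)) = decomposable u v (λ ()) refl

  unique : ∀ {t} (p q : F t) → p ≡ q
  unique (empty refl)            (empty refl)            = refl
  unique (empty refl)            (indecomposable _ ())
  unique (empty refl)            (decomposable _ _ _ ())
  unique (indecomposable _ refl) (indecomposable _ refl) = refl
  unique (indecomposable _ refl) (decomposable _ _ v≢e refl) = ⊥-elim-irr (v≢e refl)
  unique (decomposable _ _ v≢e refl) (indecomposable _ refl) = ⊥-elim-irr (v≢e refl)
  unique (decomposable _ _ _ refl)   (decomposable _ _ _ refl) = refl

⊕-⊖ : ∀ t u v → t ≢ e → u ≢ e → (t ⊕ u) ⊖ v ≡ t ⊕ (u ⊖ v)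
⊕-⊖ e                       u          v t≢e u≢e = ⊥-elim (t≢e refl)
⊕-⊖ (node a b)              e          v t≢e u≢e = ⊥-elim (u≢e refl)
⊕-⊖ (node a e)              (node _ _) v t≢e u≢e = refl
⊕-⊖ (node a b@(node _ _)) u@(node _ _) v t≢e u≢e =
  cong (node a) (⊕-⊖ b u v (λ ()) u≢e)

h-γ : ∀ t → h (γ t) ≡ ƛ (h t)
h-γ e          = refl
h-γ (node u v) = cong (_⊖ γ (h u)) (h-γ v)

⊖-nonempty : ∀ t u v → ∃[ a ] ∃[ b ] t ⊖ node u v ≡ node a b
⊖-nonempty e                   u v = u , v , refl
⊖-nonempty (node a e)          u v = _ , _ , refl
⊖-nonempty (node a (node _ _)) u v = _ , _ , refl

γ-nonempty : ∀ t → ∃[ a ] ∃[ b ] γ t ≡ node a b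
γ-nonempty e          = _ , _ , refl
γ-nonempty (node _ _) = _ , _ , refl

h-node : ∀ u v → ∃[ a ] ∃[ b ] h (node u v) ≡ node a b
h-node u v with γ (h u) | γ-nonempty (h u)
... | _ | a , b , refl = ⊖-nonempty (h v) a b

ƛ⊕-⊖ : ∀ s t w → t ≢ e → (ƛ s ⊕ t) ⊖ w ≡ ƛ s ⊕ (t ⊖ w)
ƛ⊕-⊖ s t w t≢e = ⊕-⊖ (ƛ s) t w (λ ()) t≢e

h-⊖-γ : ∀ t s → h (t ⊖ γ s) ≡ ƛ (h s) ⊕ h t
h-⊖-γ e                   s = h-γ s
h-⊖-γ (node u e)          s = cong γ (h-⊖-γ u s)
h-⊖-γ (node u v@(node a b)) s = trans
  (cong (_⊖ γ (h u)) (h-⊖-γ v s))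
  (ƛ⊕-⊖ (h s) (h v) (γ (h u)) hv≢e)
  where
  hv≢e : h v ≢ e
  hv≢e p with () ← trans (sym p) (proj₂ (proj₂ (h-node a b)))

h-involutive : ∀ t → h (h t) ≡ t
h-involutive e          = refl
h-involutive (node u v) = trans (h-⊖-γ (h v) (h u))
  (cong₂ node (h-involutive u) (h-involutive v))

rev-⊕ : ∀ t u → rev (t ⊕ u) ≡ rev u ⊕ rev t
rev-⊕ e          u = sym (⊕-identityʳ (rev u))
rev-⊕ (node a b) u =
  trans (cong (_⊕ ƛ (rev a)) (rev-⊕ b u)) (⊕-assoc (rev u) (rev b) (ƛ (rev a)))

rev-involutive : ∀ t → rev (rev t) ≡ t
rev-involutive e          = refl
rev-involutive (node u v) = trans (rev-⊕ (rev v) (ƛ (rev u)))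
  (cong₂ node (rev-involutive u) (rev-involutive v))

size-⊖ : ∀ t u → size (t ⊖ u) ≡ size t + size u
size-⊖ e          w = refl
size-⊖ (node u e) w = cong suc (begin
  size (u ⊖ w) + 0          ≡⟨ +-identityʳ _ ⟩
  size (u ⊖ w)              ≡⟨ size-⊖ u w ⟩
  size u + size w           ≡⟨ cong (_+ size w) (+-identityʳ (size u)) ⟨
  (size u + 0) + size w     ∎)
  where open ≡-Reasoning
size-⊖ (node u v@(node _ _)) w = cong suc
  (trans (cong (size u +_) (size-⊖ v w)) (sym (+-assoc (size u) (size v) (size w))))

size-γ : ∀ t → size (γ t) ≡ suc (size t)
size-γ t = trans (size-⊕ t (ƛ e)) (+-comm (size t) 1)

h-size : ∀ t → size (h t) ≡ size t
h-size e          = refl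
h-size (node u v) = begin
  size (h v ⊖ γ (h u))        ≡⟨ size-⊖ (h v) (γ (h u)) ⟩
  size (h v) + size (γ (h u)) ≡⟨ cong₂ _+_ (h-size v) (trans (size-γ (h u)) (cong suc (h-size u))) ⟩
  size v + suc (size u)       ≡⟨ +-comm (size v) (suc (size u)) ⟩
  suc (size u + size v)       ∎
  where open ≡-Reasoning

rev-size : ∀ t → size (rev t) ≡ size t
rev-size e          = refl
rev-size (node u v) = begin
  size (rev v ⊕ ƛ (rev u))        ≡⟨ size-⊕ (rev v) (ƛ (rev u)) ⟩
  size (rev v) + size (ƛ (rev u)) ≡⟨ cong₂ _+_ (rev-size v) (cong suc (trans (+-identityʳ _) (rev-size u))) ⟩
  size v + suc (size u)           ≡⟨ +-comm (size v) (suc (size u)) ⟩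
  suc (size u + size v)           ∎
  where open ≡-Reasoning

open Inverse using (to; from; strictlyInverseˡ; strictlyInverseʳ)

-- Permutations are compared by their underlying functions, and
-- (π ∙ ρ) x = π (ρ x).
Sym : Set → Group 0ℓ 0ℓ
Sym A = record
  { Carrier = A ↔ A
  ; _≈_     = λ π ρ → ∀ x → to π x ≡ to ρ x
  ; _∙_     = _↔-∘_
  ; ε       = ↔-id A
  ; _⁻¹     = ↔-sym
  ; isGroup = record
      { isMonoid = record
          { isSemigroup = record
              { isMagma = record
                  { isEquivalence = record
                      { refl  = λ _ → refl
                      ; sym   = λ p x → sym (p x)
                      ; trans = λ p q x → trans (p x) (q x)
                      }
                  ; ∙-cong = λ {π} {π′} {ρ} {ρ′} p q x → trans (cong (to π) (q x)) (p (to ρ′ x))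
                  }
              ; assoc = λ _ _ _ _ → refl
              }
          ; identity = (λ _ _ → refl) , (λ _ _ → refl)
          }
      ; inverse = strictlyInverseʳ , strictlyInverseˡ
      ; ⁻¹-cong = λ {π} {ρ} p x → begin
          from π x                      ≡⟨ cong (from π) (strictlyInverseˡ ρ x) ⟨
          from π (to ρ (from ρ x))      ≡⟨ cong (from π) (p (from ρ x)) ⟨
          from π (to π (from ρ x))      ≡⟨ strictlyInverseʳ π (from ρ x) ⟩
          from ρ x                      ∎
      }
  }
  where open ≡-Reasoning

𝐡 𝐫𝐞𝐯 𝐌 : C ↔ C
𝐡   = mk↔ₛ′ h h h-involutive h-involutive
𝐫𝐞𝐯 = mk↔ₛ′ rev rev rev-involutive rev-involutive
𝐌   = 𝐡 ↔-∘ 𝐫𝐞𝐯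

C⟨_⟩ : ℕ → Set
C⟨ n ⟩ = Σ[ t ∈ C ] size t ≡ n

SizePreserving : C ↔ C → Set
SizePreserving π = ∀ t → size (to π t) ≡ size t

C⟨⟩-≡ : ∀ {n} {x y : C⟨ n ⟩} → proj₁ x ≡ proj₁ y → x ≡ y
C⟨⟩-≡ {x = t , p} {y = .t , q} refl = cong (t ,_) (≡-irrelevant p q)

restrict : (π : C ↔ C) → SizePreserving π → ∀ n → C⟨ n ⟩ ↔ C⟨ n ⟩
restrict π size-π n = mk↔ₛ′
  (λ (t , p) → to π t , trans (size-π t) p)
  (λ (t , p) → from π t ,
    trans (sym (size-π (from π t))) (trans (cong size (strictlyInverseˡ π t)) p))
  (λ (t , _) → C⟨⟩-≡ (strictlyInverseˡ π t))
  (λ (t , _) → C⟨⟩-≡ (strictlyInverseʳ π t))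

M-size : SizePreserving 𝐌
M-size t = trans (h-size (rev t)) (rev-size t)

M↾C⟨_⟩ : ∀ n → C⟨ n ⟩ ↔ C⟨ n ⟩
M↾C⟨ n ⟩ = restrict 𝐌 M-size n

module _ {c ℓ} (G : Group c ℓ) where
  open Group G
  -- The library writes the k-th power of g as k × g.
  open RawMonoidDefinitions rawMonoid using () renaming (_×_ to _times_)

  HasOrder : Carrier → ℕ → Set ℓ
  HasOrder g k = 0 < k × (k times g) ≈ ε × (∀ j → 0 < j → j < k → ¬ ((j times g) ≈ ε))

  HasInfiniteOrder : Carrier → Set ℓ
  HasInfiniteOrder g = ∀ k → 0 < k → ¬ ((k times g) ≈ ε)

module _ {c ℓ p} (G : Group c ℓ) (S : Pred (Group.Carrier G) p) where
  open Group G renaming (refl to ≈-refl; sym to ≈-sym; trans to ≈-trans)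

  data Generated : Carrier → Set (c ⊔ ℓ ⊔ p) where
    gen  : ∀ {x} → S x → Generated x
    unit : Generated ε
    mul  : ∀ {x y} → Generated x → Generated y → Generated (x ∙ y)
    inv  : ∀ {x} → Generated x → Generated (x ⁻¹)
    resp : ∀ {x y} → x ≈ y → Generated x → Generated y

  GeneratedSubgroup : Group (c ⊔ ℓ ⊔ p) ℓ
  GeneratedSubgroup = record
    { Carrier = ∃ Generated
    ; _≈_     = λ (x , _) (y , _) → x ≈ y
    ; _∙_     = λ (x , p) (y , q) → x ∙ y , mul p q
    ; ε       = ε , unit
    ; _⁻¹     = λ (x , p) → x ⁻¹ , inv p
    ; isGroup = record
        { isMonoid = record
            { isSemigroup = record
                { isMagma = record
                    { isEquivalence = record
                        { refl = ≈-refl ; sym = ≈-sym ; trans = ≈-trans }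
                    ; ∙-cong = ∙-cong
                    }
                ; assoc = λ (x , _) (y , _) (z , _) → assoc x y z
                }
            ; identity = (λ (x , _) → identityˡ x) , (λ (x , _) → identityʳ x)
            }
        ; inverse = (λ (x , _) → inverseˡ x) , (λ (x , _) → inverseʳ x)
        ; ⁻¹-cong = ⁻¹-cong
        }
    }

⟨h,rev⟩ : Group 0ℓ 0ℓ
⟨h,rev⟩ = GeneratedSubgroup (Sym C) (λ π → π ≡ 𝐡 ⊎ π ≡ 𝐫𝐞𝐯)

module FreeProduct {c₁ ℓ₁ c₂ ℓ₂} (G : Group c₁ ℓ₁) (H : Group c₂ ℓ₂) where
  private
    module G = Group G
    module H = Group H

  Letter : Set (c₁ ⊔ c₂)
  Letter = G.Carrier ⊎ H.Carrier

  Word : Set (c₁ ⊔ c₂)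
  Word = List Letter

  -- The congruence on words generated by the multiplication tables of G and H.
  infix 4 _∼_
  data _∼_ : Word → Word → Set (c₁ ⊔ ℓ₁ ⊔ c₂ ⊔ ℓ₂) where
    ∼-refl  : ∀ {u} → u ∼ u
    ∼-sym   : ∀ {u v} → u ∼ v → v ∼ u
    ∼-trans : ∀ {u v w} → u ∼ v → v ∼ w → u ∼ w
    ++-cong : ∀ {u u′ v v′} → u ∼ u′ → v ∼ v′ → (u ++ v) ∼ (u′ ++ v′)
    resp₁   : ∀ {x y} → x G.≈ y → [ inj₁ x ] ∼ [ inj₁ y ]
    resp₂   : ∀ {x y} → x H.≈ y → [ inj₂ x ] ∼ [ inj₂ y ]
    unit₁   : [ inj₁ G.ε ] ∼ []
    unit₂   : [ inj₂ H.ε ] ∼ []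
    mul₁    : ∀ x y → (inj₁ x ∷ inj₁ y ∷ []) ∼ [ inj₁ (x G.∙ y) ]
    mul₂    : ∀ x y → (inj₂ x ∷ inj₂ y ∷ []) ∼ [ inj₂ (x H.∙ y) ]

  invˡ : Letter → Letter
  invˡ (inj₁ x) = inj₁ (x G.⁻¹)
  invˡ (inj₂ y) = inj₂ (y H.⁻¹)

  invʷ : Word → Word
  invʷ []      = []
  invʷ (a ∷ w) = invʷ w ++ [ invˡ a ]

  private
    ≡⇒∼ : ∀ {u v} → u ≡ v → u ∼ v
    ≡⇒∼ refl = ∼-refl

    letter-invˡ : ∀ a → (invˡ a ∷ a ∷ []) ∼ []
    letter-invˡ (inj₁ x) = ∼-trans (mul₁ _ _) (∼-trans (resp₁ (G.inverseˡ x)) unit₁)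
    letter-invˡ (inj₂ x) = ∼-trans (mul₂ _ _) (∼-trans (resp₂ (H.inverseˡ x)) unit₂)

    letter-invʳ : ∀ a → (a ∷ invˡ a ∷ []) ∼ []
    letter-invʳ (inj₁ x) = ∼-trans (mul₁ _ _) (∼-trans (resp₁ (G.inverseʳ x)) unit₁)
    letter-invʳ (inj₂ x) = ∼-trans (mul₂ _ _) (∼-trans (resp₂ (H.inverseʳ x)) unit₂)

    word-invˡ : ∀ w → (invʷ w ++ w) ∼ []
    word-invˡ []      = ∼-refl
    word-invˡ (a ∷ w) = ∼-trans (≡⇒∼ (++-assoc (invʷ w) [ invˡ a ] (a ∷ w)))
      (∼-trans (++-cong (∼-refl {invʷ w}) (++-cong (letter-invˡ a) (∼-refl {w})))
        (word-invˡ w))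

    word-invʳ : ∀ w → (w ++ invʷ w) ∼ []
    word-invʳ []      = ∼-refl
    word-invʳ (a ∷ w) = ∼-trans (≡⇒∼ (cong (a ∷_) (sym (++-assoc w (invʷ w) [ invˡ a ]))))
      (∼-trans (++-cong (∼-refl {[ a ]}) (++-cong (word-invʳ w) (∼-refl {[ invˡ a ]})))
        (letter-invʳ a))

    -- Inverses in a monoid are unique.
    inv-cong : ∀ {u v} → u ∼ v → invʷ u ∼ invʷ v
    inv-cong {u} {v} u∼v =
      ∼-trans (≡⇒∼ (sym (++-identityʳ (invʷ u))))
      (∼-trans (++-cong (∼-refl {invʷ u}) (∼-sym (word-invʳ v)))
      (∼-trans (++-cong (∼-refl {invʷ u}) (++-cong (∼-sym u∼v) (∼-refl {invʷ v})))
      (∼-trans (≡⇒∼ (sym (++-assoc (invʷ u) u (invʷ v))))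
      (++-cong (word-invˡ u) (∼-refl {invʷ v})))))

  freeProduct : Group (c₁ ⊔ c₂) (c₁ ⊔ ℓ₁ ⊔ c₂ ⊔ ℓ₂)
  freeProduct = record
    { Carrier = Word
    ; _≈_     = _∼_
    ; _∙_     = _++_
    ; ε       = []
    ; _⁻¹     = invʷ
    ; isGroup = record
        { isMonoid = record
            { isSemigroup = record
                { isMagma = record
                    { isEquivalence = record
                        { refl = ∼-refl ; sym = ∼-sym ; trans = ∼-trans }
                    ; ∙-cong = ++-cong
                    }
                ; assoc = λ u v w → ≡⇒∼ (++-assoc u v w)
                }
            ; identity = (λ _ → ∼-refl) , (λ w → ≡⇒∼ (++-identityʳ w))
            }
        ; inverse = word-invˡ , word-invʳ
        ; ⁻¹-cong = inv-cong
        }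
    }

  ι₁ : G.Carrier → Word
  ι₁ x = [ inj₁ x ]

  ι₂ : H.Carrier → Word
  ι₂ y = [ inj₂ y ]

ℤ₂ : Group 0ℓ 0ℓ
ℤ₂ = Parity.+-0-group

open FreeProduct ℤ₂ ℤ₂ public using (ι₁; ι₂) renaming (freeProduct to ℤ₂∗ℤ₂)

{-# OPTIONS --safe #-}
-- On binary trees node u v the map M = h ∘ rev satisfies M (node u v) = M u ⊕ ƛ (M v).
-- Hence the trees a₀ = ƛ e, aₙ₊₁ = ƛ (M⁻¹ aₙ) satisfy M (aₙ₊₁ ⊕ w) = aₙ ⊕ ƛ (M w), and
-- Mʲ aₙ is decomposable for 0 < j ≤ n although aₙ is not.  So no power of M is the
-- identity, and M has order greater than n on the trees of the size of aₙ.
-- For the free product, every alternating word of length at least 2 in h and rev sends some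
-- aₙ or rev aₙ to a decomposable tree.
module Submission where

open import Defs
open import Algebra.Bundles using (Group)
open import Algebra.Morphism.Structures using (IsGroupIsomorphism)
open import Data.Nat.Base using (ℕ; _<_)
open import Data.Parity.Base using (1ℙ)
open import Data.Product.Base using (_×_; _,_; Σ-syntax; ∃-syntax; proj₁)

import Algebra.Definitions.RawMonoid as RawMonoidDefinitions
import Algebra.Properties.Group as GroupProperties
import Algebra.Properties.Monoid.Mult as MonoidMult
open import Data.Bool.Base using (Bool; true; false; not)
open import Data.Fin.Base using (Fin; toℕ)
open import Data.Fin.Properties using (pigeonhole; toℕ≤pred[n])
open import Data.List.Base using (List; []; _∷_; _++_; [_]; length; concatMap; cartesianProductWith)
open import Data.List.Membership.Propositional using (_∈_)
open import Data.List.Membership.Propositional.Properties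
  using (∈-concatMap⁺; ∈-cartesianProductWith⁺)
import Data.List.Membership.Setoid.Properties as SetoidMembership
open import Data.List.Relation.Unary.All using (all?; lookup; universal)
open import Data.List.Relation.Unary.Any using (here; there; index)
import Data.List.Relation.Unary.Any as Any
open import Data.Nat.Base using (zero; suc; _+_; _*_; _∸_; _≤_; s≤s; s≤s⁻¹; z<s; _!)
open import Data.Nat.Divisibility using (_∣_; divides; ∣-trans; m∣m*n; m≤n⇒m!∣n!)
open import Data.Nat.Induction using (<-rec)
open import Data.Nat.Properties
  using (_≟_; _<?_; ≤-refl; ≤-trans; n≤1+n; m≤m+n; m≤n+m; n<1+n; ≰⇒>; <⇒≤; m<n⇒0<n∸m; m∸n≤m;
         m+[n∸m]≡n; *-monoˡ-≤; 1≤n!; anyUpTo?; _≤?_)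
open import Data.Parity.Base using (0ℙ)
open import Data.Product.Base using (proj₂)
open import Data.Sum.Base using (_⊎_; inj₁; inj₂)
open import Function.Bundles using (_↔_; Inverse)
open import Function.Definitions using (Injective)
open import Relation.Binary.Definitions using (DecidableEquality)
open import Relation.Binary.PropositionalEquality
  using (_≡_; _≢_; refl; sym; trans; cong; cong₂; subst; setoid; module ≡-Reasoning)
open import Relation.Nullary.Decidable using (yes; no; map′; _×-dec_)
open import Relation.Nullary.Negation using (¬_; contradiction)
open import Relation.Unary using (Decidable)

open Inverse using (to; from; strictlyInverseˡ; strictlyInverseʳ)

-- Orders of permutations

module _ {A : Set} where
  open RawMonoidDefinitions (Group.rawMonoid (Sym A)) using () renaming (_×_ to _times_)
  open MonoidMult (Group.monoid (Sym A)) using (×-homo-+)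

  pow : A ↔ A → ℕ → A → A
  pow π k = to (k times π)

  pow-+ : ∀ π m n x → pow π (m + n) x ≡ pow π m (pow π n x)
  pow-+ π = ×-homo-+ π

  pow-shift : ∀ π k x → pow π k (to π x) ≡ pow π (suc k) x
  pow-shift π zero    x = refl
  pow-shift π (suc k) x = cong (to π) (pow-shift π k x)

  pow-injective : ∀ π k {x y} → pow π k x ≡ pow π k y → x ≡ y
  pow-injective π k {x} {y} eq =
    trans (sym (strictlyInverseʳ (k times π) x))
      (trans (cong (from (k times π)) eq) (strictlyInverseʳ (k times π) y))

  pow-*-fixed : ∀ π p x → pow π p x ≡ x → ∀ q → pow π (q * p) x ≡ x
  pow-*-fixed π p x fix zero    = refl
  pow-*-fixed π p x fix (suc q) =
    trans (pow-+ π p (q * p) x) (trans (cong (pow π p) (pow-*-fixed π p x fix q)) fix)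

  pow-collision : ∀ π i j x → i ≤ j → pow π i x ≡ pow π j x → pow π (j ∸ i) x ≡ x
  pow-collision π i j x i≤j eq = pow-injective π i (begin
    pow π i (pow π (j ∸ i) x) ≡⟨ pow-+ π i (j ∸ i) x ⟨
    pow π (i + (j ∸ i)) x     ≡⟨ cong (λ k → pow π k x) (m+[n∸m]≡n i≤j) ⟩
    pow π j x                 ≡⟨ eq ⟨
    pow π i x                 ∎)
    where open ≡-Reasoning

n∣m! : ∀ {m n} → 0 < n → n ≤ m → n ∣ m !
n∣m! {n = suc n} _ n≤m = ∣-trans (m∣m*n (n !)) (m≤n⇒m!∣n! n≤m)

-- Among the `N + 1` points `x`, `π x`, ..., `πᴺ x` two coincide by the pigeonhole principle. So `x`
-- returns after some number of steps between 1 and `N`, which divides `N !`. This exponent is the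
-- same for every `x`.
pow-!-identity : ∀ {A : Set} {N} (π : A ↔ A) (f : A → Fin N) → Injective _≡_ _≡_ f →
                 ∀ x → pow π (N !) x ≡ x
pow-!-identity {N = N} π f f-inj x
  with i , j , i<j , eq ← pigeonhole (n<1+n N) (λ i → f (pow π (toℕ i) x))
  with divides q N!≡q*p ← n∣m! (m<n⇒0<n∸m i<j) (≤-trans (m∸n≤m (toℕ j) (toℕ i)) (toℕ≤pred[n] j))
  = trans (cong (λ k → pow π k x) N!≡q*p)
      (pow-*-fixed π (toℕ j ∸ toℕ i) x
        (pow-collision π (toℕ i) (toℕ j) x (<⇒≤ i<j) (f-inj eq)) q)

least : ∀ {P : ℕ → Set} → Decidable P → ∀ k → P k → ∃[ j ] P j × (∀ i → i < j → ¬ P i)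
least {P} P? = <-rec _ step
  where
  step : ∀ k → (∀ {j} → j < k → P j → ∃[ j ] P j × (∀ i → i < j → ¬ P i)) →
         P k → ∃[ j ] P j × (∀ i → i < j → ¬ P i)
  step k rec Pk with anyUpTo? P? k
  ... | yes (j , j<k , Pj) = rec j<k Pj
  ... | no  none           = k , Pk , λ i i<k Pi → none (i , i<k , Pi)

module _ {A : Set} (_≟_ : DecidableEquality A) (xs : List A) (complete : ∀ x → x ∈ xs)
         (π : A ↔ A) where

  positive-exponent? : Decidable (λ k → 0 < k × (∀ x → pow π k x ≡ x))
  positive-exponent? k = (0 <? k) ×-dec
    map′ (λ all x → lookup all (complete x)) (λ πᵏ≡id → universal πᵏ≡id xs)
         (all? (λ x → pow π k x ≟ x) xs)

  -- A complete list makes "the `k`-th power is the identity" decidable, and the factorial of its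
  -- length is one positive exponent with this property, so a least one exists. Repetitions in the
  -- list do no harm, since only the injectivity of positions is used.
  finite-order : ∃[ k ] HasOrder (Sym A) π k
  finite-order
    with k , (0<k , πᵏ≡id) , minimal ← least positive-exponent? (length xs !)
           (1≤n! (length xs) , pow-!-identity π (λ x → index (complete x))
             (λ {x} {y} → SetoidMembership.index-injective (setoid A) (complete x) (complete y)))
    = k , 0<k , πᵏ≡id , λ j 0<j j<k πʲ≡id → minimal j j<k (0<j , πʲ≡id)

-- Finiteness of the sets C⟨ n ⟩

node-injective : ∀ {a b c d} → node a b ≡ node c d → a ≡ c × b ≡ d
node-injective refl = refl , refl

_≟ᶜ_ : DecidableEquality C
e        ≟ᶜ e        = yes refl
e        ≟ᶜ node _ _ = no λ ()
node _ _ ≟ᶜ e        = no λ ()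
node a b ≟ᶜ node c d =
  map′ (λ (p , q) → cong₂ node p q) node-injective ((a ≟ᶜ c) ×-dec (b ≟ᶜ d))

-- The bound is on the height as a binary tree, which keeps the recursion free of sums. Size bounds
-- height, so every tree of size at most `n` is listed; larger ones also occur and are discarded by
-- `ofSize`.
trees≤ : ℕ → List C
trees≤ zero    = [ e ]
trees≤ (suc n) = e ∷ cartesianProductWith node (trees≤ n) (trees≤ n)

∈-trees≤ : ∀ t {n} → size t ≤ n → t ∈ trees≤ n
∈-trees≤ e          {zero}  _       = here refl
∈-trees≤ e          {suc n} _       = here refl
∈-trees≤ (node u v) {suc n} (s≤s p) = there (∈-cartesianProductWith⁺ node
  (∈-trees≤ u (≤-trans (m≤m+n (size u) (size v)) p))
  (∈-trees≤ v (≤-trans (m≤n+m (size v) (size u)) p)))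

ofSize : ∀ n → C → List C⟨ n ⟩
ofSize n t with size t ≟ n
... | yes p = [ t , p ]
... | no  _ = []

∈-ofSize : ∀ {n} (x : C⟨ n ⟩) → x ∈ ofSize n (proj₁ x)
∈-ofSize {n} (t , p) with size t ≟ n
... | yes _ = here (C⟨⟩-≡ refl)
... | no ¬p = contradiction p ¬p

C⟨⟩-list : ∀ n → List C⟨ n ⟩
C⟨⟩-list n = concatMap (ofSize n) (trees≤ n)

∈-C⟨⟩-list : ∀ {n} (x : C⟨ n ⟩) → x ∈ C⟨⟩-list n
∈-C⟨⟩-list x@(t , refl) = ∈-concatMap⁺ (ofSize (size t))
  (Any.map (λ { refl → ∈-ofSize x }) (∈-trees≤ t ≤-refl))

C⟨⟩-≟ : ∀ {n} → DecidableEquality C⟨ n ⟩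
C⟨⟩-≟ x y = map′ C⟨⟩-≡ (cong proj₁) (proj₁ x ≟ᶜ proj₁ y)

pow-M↾ : ∀ {n} k (x : C⟨ n ⟩) → proj₁ (pow M↾C⟨ n ⟩ k x) ≡ pow 𝐌 k (proj₁ x)
pow-M↾ zero    x = refl
pow-M↾ (suc k) x = cong (to 𝐌) (pow-M↾ k x)

-- Trees with long orbits

M : C → C
M = to 𝐌

⊕-ƛ-⊖ : ∀ t u v → (t ⊕ ƛ u) ⊖ v ≡ t ⊕ ƛ (u ⊖ v)
⊕-ƛ-⊖ e            u v = refl
⊕-ƛ-⊖ t@(node _ _) u v = ⊕-⊖ t (ƛ u) v (λ ()) (λ ())

-- By induction on `t`: the factor `⊖ γ (h u)` acts inside the last child only, so it leaves `h s`
-- alone and turns the last child `h v` into `h (node u v)`.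
h-⊕-ƛ : ∀ t s → h (t ⊕ ƛ s) ≡ h s ⊕ ƛ (h t)
h-⊕-ƛ e          s = refl
h-⊕-ƛ (node u v) s = trans (cong (_⊖ γ (h u)) (h-⊕-ƛ v s)) (⊕-ƛ-⊖ (h s) (h v) (γ (h u)))

M-node : ∀ u v → M (node u v) ≡ M u ⊕ ƛ (M v)
M-node u v = h-⊕-ƛ (rev v) (rev u)

-- The only child of `a n`, chosen so that `M` sends `stem (suc n)` to `a n`.
stem : ℕ → C
stem zero    = e
stem (suc n) = from 𝐌 (ƛ (stem n))

a : ℕ → C
a n = ƛ (stem n)

M-a : ∀ n w → M (a (suc n) ⊕ w) ≡ a n ⊕ ƛ (M w)
M-a n w = trans (M-node (stem (suc n)) w) (cong (_⊕ ƛ (M w)) (strictlyInverseˡ 𝐌 (a n)))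

-- Trees with at least two children. The index unfolds to `node u (node v w)`, so a nonempty second
-- summand is visible to pattern matching without a side condition.
data Decomposable : C → Set where
  decomposable : ∀ {u v w} → Decomposable (ƛ u ⊕ ƛ v ⊕ w)

decomposable≢ƛ : ∀ {t u} → Decomposable t → t ≢ ƛ u
decomposable≢ƛ decomposable ()

-- Alternating products of `h` and `rev`

act : Bool → C → C
act true  = h
act false = rev

act-involutive : ∀ b t → act b (act b t) ≡ t
act-involutive true  = h-involutive
act-involutive false = rev-involutive

-- The alternating product of n factors h and rev whose rightmost factor is act b.
alternating : Bool → ℕ → C → C
alternating b zero    t = t
alternating b (suc n) t = alternating (not b) n (act b t)

-- The two rightmost factors form `M`, which by `M-a` replaces `a (suc m) ⊕ ƛ w` by a tree of the
-- same shape with `m` in place of `suc m`. If one factor remains it is `rev`, which preserves the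
-- number of children.
alternating-decomposable : ∀ n m w → n ≤ m → Decomposable (alternating false n (a m ⊕ ƛ w))
alternating-decomposable zero          m       w _   = decomposable
alternating-decomposable (suc zero)    m       w _   = decomposable
alternating-decomposable (suc (suc n)) (suc m) w n≤m =
  subst (λ t → Decomposable (alternating false n t)) (sym (M-a m (ƛ w)))
    (alternating-decomposable n m (M (ƛ w)) (≤-trans (n≤1+n n) (s≤s⁻¹ n≤m)))

alternating-a : ∀ n m → n ≤ m → Decomposable (alternating false (2 + n) (a (suc m)))
alternating-a n m n≤m =
  -- Here `w` is `e`: the tree `a (suc m)` is `a (suc m) ⊕ e` by computation, and `M` gives it a
  -- second child `M e`, which is `e`.
  subst (λ t → Decomposable (alternating false n t)) (sym (M-a m e))
    (alternating-decomposable n m e n≤m)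

alternating-identity : ∀ b n → (∀ t → alternating b n t ≡ t) → n ≡ 0
alternating-identity b     zero          _  = refl
-- The argument `rev (a (suc n))` supplies a further factor `rev` on the right, so that
-- `alternating-a` applies; this argument is itself of the form `ƛ s`.
alternating-identity true  (suc n)       id =
  contradiction (id (rev (a (suc n)))) (decomposable≢ƛ (alternating-a n n ≤-refl))
-- A single `rev` keeps every `ƛ s` indecomposable, so a tree with two different children serves as
-- witness instead.
alternating-identity false (suc zero)    id with () ← id (ƛ e ⊕ ƛ (ƛ e))
alternating-identity false (suc (suc n)) id =
  contradiction (id (a (suc n))) (decomposable≢ƛ (alternating-a n n ≤-refl))

pow-M-alternating : ∀ k t → pow 𝐌 k t ≡ alternating false (k * 2) t
pow-M-alternating zero    t = refl
-- Powers add the new `M` on the left, alternating products on the right; `pow-shift` moves it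
-- across.
pow-M-alternating (suc k) t = trans (sym (pow-shift 𝐌 k t)) (pow-M-alternating k (M t))

pow-M-a : ∀ j m → j * 2 ≤ m → pow 𝐌 (suc j) (a (suc m)) ≢ a (suc m)
pow-M-a j m j≤m = decomposable≢ƛ
  (subst Decomposable (sym (pow-M-alternating (suc j) (a (suc m)))) (alternating-a (j * 2) m j≤m))

-- Orders of `M` and of the generators

M-infinite-order : HasInfiniteOrder (Sym C) 𝐌
M-infinite-order (suc j) _ Mᵏ≡id = pow-M-a j (j * 2) ≤-refl (Mᵏ≡id _)

M↾-order : ∀ n → ∃[ k ] HasOrder (Sym C⟨ n ⟩) M↾C⟨ n ⟩ k
M↾-order n = finite-order C⟨⟩-≟ (C⟨⟩-list n) ∈-C⟨⟩-list M↾C⟨ n ⟩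

M↾-order-unbounded : ∀ b k → HasOrder (Sym C⟨ size (a (suc (b * 2))) ⟩) M↾C⟨ _ ⟩ k → b < k
M↾-order-unbounded b (suc j) (_ , Mᵏ≡id , _) with suc j ≤? b
... | no  k≰b = ≰⇒> k≰b
... | yes k≤b = contradiction
  (trans (sym (pow-M↾ (suc j) x)) (cong proj₁ (Mᵏ≡id x)))
  (pow-M-a j (b * 2) (*-monoˡ-≤ 2 (<⇒≤ k≤b)))
  where
  x : C⟨ size (a (suc (b * 2))) ⟩
  x = a (suc (b * 2)) , refl

involution-order : ∀ (π : C ↔ C) → (∀ t → to π (to π t) ≡ t) → ∃[ t ] to π t ≢ t →
                   HasOrder (Sym C) π 2
involution-order π π-involutive (t , πt≢t) = z<s , π-involutive , λ
  { (suc zero)    _ _ π≡id → πt≢t (π≡id t)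
  ; (suc (suc _)) _ (s≤s (s≤s ())) }

-- The free product

open FreeProduct ℤ₂ ℤ₂
  using (Letter; Word; _∼_; ∼-refl; ∼-sym; ∼-trans; ++-cong;
         resp₁; resp₂; unit₁; unit₂; mul₁; mul₂)

module ⟨h,rev⟩ = Group ⟨h,rev⟩
module ℤ₂∗ℤ₂ = Group ℤ₂∗ℤ₂

evalLetter : Letter → ⟨h,rev⟩.Carrier
evalLetter (inj₁ 0ℙ) = ⟨h,rev⟩.ε
evalLetter (inj₁ 1ℙ) = 𝐡 , gen (inj₁ refl)
evalLetter (inj₂ 0ℙ) = ⟨h,rev⟩.ε
evalLetter (inj₂ 1ℙ) = 𝐫𝐞𝐯 , gen (inj₂ refl)

eval : Word → ⟨h,rev⟩.Carrier
eval []      = ⟨h,rev⟩.ε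
eval (x ∷ w) = evalLetter x ⟨h,rev⟩.∙ eval w

⟦_⟧ : Word → C → C
⟦ w ⟧ = to (proj₁ (eval w))

⟦++⟧ : ∀ u v t → ⟦ u ++ v ⟧ t ≡ ⟦ u ⟧ (⟦ v ⟧ t)
⟦++⟧ []      v t = refl
⟦++⟧ (x ∷ u) v t = cong (to (proj₁ (evalLetter x))) (⟦++⟧ u v t)

-- The relations from the multiplication tables hold by computation, except `1ℙ + 1ℙ = 0ℙ` in each
-- factor, which is the involutivity of `h` or of `rev`.
⟦⟧-cong : ∀ {u v} → u ∼ v → ∀ t → ⟦ u ⟧ t ≡ ⟦ v ⟧ t
⟦⟧-cong ∼-refl        t = refl
⟦⟧-cong (∼-sym p)     t = sym (⟦⟧-cong p t)
⟦⟧-cong (∼-trans p q) t = trans (⟦⟧-cong p t) (⟦⟧-cong q t)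
⟦⟧-cong (++-cong {u} {u′} {v} {v′} p q) t = begin
  ⟦ u ++ v ⟧ t       ≡⟨ ⟦++⟧ u v t ⟩
  ⟦ u ⟧ (⟦ v ⟧ t)    ≡⟨ cong ⟦ u ⟧ (⟦⟧-cong q t) ⟩
  ⟦ u ⟧ (⟦ v′ ⟧ t)   ≡⟨ ⟦⟧-cong p (⟦ v′ ⟧ t) ⟩
  ⟦ u′ ⟧ (⟦ v′ ⟧ t)  ≡⟨ ⟦++⟧ u′ v′ t ⟨
  ⟦ u′ ++ v′ ⟧ t     ∎
  where open ≡-Reasoning
⟦⟧-cong (resp₁ refl)   t = refl
⟦⟧-cong (resp₂ refl)   t = refl
⟦⟧-cong unit₁          t = refl
⟦⟧-cong unit₂          t = refl
⟦⟧-cong (mul₁ 0ℙ _)  t = refl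
⟦⟧-cong (mul₁ 1ℙ 0ℙ) t = refl
⟦⟧-cong (mul₁ 1ℙ 1ℙ) t = h-involutive t
⟦⟧-cong (mul₂ 0ℙ _)  t = refl
⟦⟧-cong (mul₂ 1ℙ 0ℙ) t = refl
⟦⟧-cong (mul₂ 1ℙ 1ℙ) t = rev-involutive t

eval-⁻¹ : ∀ w → eval (w ℤ₂∗ℤ₂.⁻¹) ⟨h,rev⟩.≈ (eval w ⟨h,rev⟩.⁻¹)
eval-⁻¹ w = GroupProperties.inverseˡ-unique ⟨h,rev⟩ (eval (w ℤ₂∗ℤ₂.⁻¹)) (eval w)
  λ t → trans (sym (⟦++⟧ (w ℤ₂∗ℤ₂.⁻¹) w t)) (⟦⟧-cong (ℤ₂∗ℤ₂.inverseˡ w) t)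

-- Normal forms of words

generator : Bool → Letter
generator true  = inj₁ 1ℙ
generator false = inj₂ 1ℙ

alternatingWord : Bool → ℕ → Word
alternatingWord b zero    = []
alternatingWord b (suc n) = generator b ∷ alternatingWord (not b) n

generator² : ∀ b → (generator b ∷ generator b ∷ []) ∼ []
generator² true  = ∼-trans (mul₁ 1ℙ 1ℙ) unit₁
generator² false = ∼-trans (mul₂ 1ℙ 1ℙ) unit₂

Alternating : Word → Set
Alternating w = ∃[ b ] ∃[ n ] w ∼ alternatingWord b n

-- A generator put in front of a nonempty alternating word either equals its first letter, and the
-- two cancel, or prolongs the alternation.
generator-∷-alternating : ∀ c b n → Alternating (generator c ∷ alternatingWord b n)
generator-∷-alternating c     b     zero    = c , 1 , ∼-refl
generator-∷-alternating true  true  (suc n) =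
  false , n , ++-cong (generator² true) (∼-refl {alternatingWord false n})
generator-∷-alternating true  false (suc n) = true , 2 + n , ∼-refl
generator-∷-alternating false true  (suc n) = false , 2 + n , ∼-refl
generator-∷-alternating false false (suc n) =
  true , n , ++-cong (generator² false) (∼-refl {alternatingWord true n})

∷-alternating : ∀ x b n → Alternating (x ∷ alternatingWord b n)
∷-alternating (inj₁ 0ℙ) b n = b , n , ++-cong unit₁ ∼-refl
∷-alternating (inj₁ 1ℙ) b n = generator-∷-alternating true b n
∷-alternating (inj₂ 0ℙ) b n = b , n , ++-cong unit₂ ∼-refl
∷-alternating (inj₂ 1ℙ) b n = generator-∷-alternating false b n

normalForm : ∀ w → Alternating w
normalForm []      = true , 0 , ∼-refl
normalForm (x ∷ w) with b , n , w∼ ← normalForm w with c , m , x∷∼ ← ∷-alternating x b n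
  = c , m , ∼-trans (++-cong (∼-refl {[ x ]}) w∼) x∷∼

⟦generator⟧ : ∀ b t → to (proj₁ (evalLetter (generator b))) t ≡ act b t
⟦generator⟧ true  t = refl
⟦generator⟧ false t = refl

-- alternating b n and ⟦ alternatingWord b n ⟧ list the same factors in opposite orders.
alternating-⟦⟧ : ∀ b n t → alternating b n (⟦ alternatingWord b n ⟧ t) ≡ t
alternating-⟦⟧ b zero    t = refl
alternating-⟦⟧ b (suc n) t = begin
  alternating (not b) n (act b (⟦ alternatingWord b (suc n) ⟧ t))
    ≡⟨ cong (λ s → alternating (not b) n (act b s)) (⟦generator⟧ b (⟦ w ⟧ t)) ⟩
  alternating (not b) n (act b (act b (⟦ w ⟧ t)))
    ≡⟨ cong (alternating (not b) n) (act-involutive b (⟦ w ⟧ t)) ⟩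
  alternating (not b) n (⟦ w ⟧ t)
    ≡⟨ alternating-⟦⟧ (not b) n t ⟩
  t ∎
  where
  open ≡-Reasoning
  w = alternatingWord (not b) n

-- The isomorphism

eval-kernel : ∀ w → (∀ t → ⟦ w ⟧ t ≡ t) → w ∼ []
eval-kernel w w≡id with b , n , w∼ ← normalForm w
  -- The normal form also acts as the identity, hence so does its left inverse `alternating b n`,
  -- which forces `n` to be 0 and the normal form to be empty.
  with refl ← alternating-identity b n (λ t →
    trans (cong (alternating b n) (trans (sym (w≡id t)) (⟦⟧-cong w∼ t))) (alternating-⟦⟧ b n t))
  = w∼

-- Triviality of the kernel is applied to `u` times the inverse of `v`.
eval-injective : ∀ {u v} → eval u ⟨h,rev⟩.≈ eval v → u ∼ v
eval-injective {u} {v} u≈v =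
  GroupProperties.x∙y⁻¹≈ε⇒x≈y ℤ₂∗ℤ₂ u v (eval-kernel (u ++ v ℤ₂∗ℤ₂.⁻¹) λ t →
    trans (⟦++⟧ u (v ℤ₂∗ℤ₂.⁻¹) t)
      (trans (u≈v (⟦ v ℤ₂∗ℤ₂.⁻¹ ⟧ t))
        (trans (sym (⟦++⟧ v (v ℤ₂∗ℤ₂.⁻¹) t)) (⟦⟧-cong (ℤ₂∗ℤ₂.inverseʳ v) t))))

eval-surjective : ∀ {π} → Generated (Sym C) (λ π → π ≡ 𝐡 ⊎ π ≡ 𝐫𝐞𝐯) π →
                  ∃[ w ] (∀ t → ⟦ w ⟧ t ≡ to π t)
eval-surjective (gen (inj₁ refl)) = ι₁ 1ℙ , λ _ → refl
eval-surjective (gen (inj₂ refl)) = ι₂ 1ℙ , λ _ → refl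
eval-surjective unit              = [] , λ _ → refl
eval-surjective (mul {x} {y} p q) with u , u≈x ← eval-surjective p with v , v≈y ← eval-surjective q
  = u ++ v , λ t → trans (⟦++⟧ u v t) (trans (cong ⟦ u ⟧ (v≈y t)) (u≈x (to y t)))
eval-surjective (inv {x} p) with w , w≈x ← eval-surjective p
  = w ℤ₂∗ℤ₂.⁻¹ , λ t → trans (eval-⁻¹ w t)
      (Group.⁻¹-cong (Sym C) {proj₁ (eval w)} {x} w≈x t)
eval-surjective (resp x≈y p) with w , w≈x ← eval-surjective p
  = w , λ t → trans (w≈x t) (x≈y t)

eval-isGroupIsomorphism :
  IsGroupIsomorphism (Group.rawGroup ℤ₂∗ℤ₂) (Group.rawGroup ⟨h,rev⟩) eval
eval-isGroupIsomorphism = record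
  { isGroupMonomorphism = record
      { isGroupHomomorphism = record
          { isMonoidHomomorphism = record
              { isMagmaHomomorphism = record
                  { isRelHomomorphism = record { cong = ⟦⟧-cong }
                  ; homo              = ⟦++⟧
                  }
              ; ε-homo = λ _ → refl
              }
          ; ⁻¹-homo = eval-⁻¹
          }
      ; injective = eval-injective
      }
  ; surjective = λ (π , p) → let w , w≈π = eval-surjective p in
      w , λ z∼w t → trans (⟦⟧-cong z∼w t) (w≈π t)
  }

corollary5p11 : (HasOrder (Sym C) 𝐡 2 × HasOrder (Sym C) 𝐫𝐞𝐯 2
    × (Σ[ φ ∈ (Group.Carrier ℤ₂∗ℤ₂ → Group.Carrier ⟨h,rev⟩) ]
    (IsGroupIsomorphism (Group.rawGroup ℤ₂∗ℤ₂) (Group.rawGroup ⟨h,rev⟩) φ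
    × Group._≈_ (Sym C) (proj₁ (φ (ι₁ 1ℙ))) 𝐡
    × Group._≈_ (Sym C) (proj₁ (φ (ι₂ 1ℙ))) 𝐫𝐞𝐯)))
    × HasInfiniteOrder (Sym C) 𝐌
    × (Σ[ ord ∈ (ℕ → ℕ) ]
    ((∀ n → HasOrder (Sym C⟨ n ⟩) M↾C⟨ n ⟩ (ord n))
    × (∀ (b : ℕ) → ∃[ n ] b < ord n)))
corollary5p11 =
  -- `h` sends the path `ƛ (ƛ e)` to `ƛ e ⊕ ƛ e`, and `rev` swaps the two different children of
  -- `ƛ e ⊕ ƛ (ƛ e)`.
  ( involution-order 𝐡 h-involutive (ƛ (ƛ e) , λ ())
  , involution-order 𝐫𝐞𝐯 rev-involutive (ƛ e ⊕ ƛ (ƛ e) , λ ())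
  , eval , eval-isGroupIsomorphism , (λ _ → refl) , (λ _ → refl))
  , M-infinite-order
  , (λ n → proj₁ (M↾-order n))
  , (λ n → proj₂ (M↾-order n))
  , (λ b → size (a (suc (b * 2))) , M↾-order-unbounded b _ (proj₂ (M↾-order _)))
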